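{- Let $(H,f)$ be a vertex-weighted graph where $H$ is connected with at least one edge and $f$ is not identically zero, and let $G=L(H,f)$. Then $k(G)=1$ if one of the following holds: (i) $f(u)=f(v)=1$ for some edge $uv$ of $H$; (ii) $f(v)\le 1$ for every vertex $v$ of $H$.
   Context: All graphs are finite and simple. For a digraph $D$, its competition graph $C(D)$ has vertex set $V(D)$, two distinct vertices $u,v$ adjacent iff some vertex $x$ satisfies $(u,x),(v,x)\in A(D)$. The competition number $k(G)$ is the smallest nonnegative integer $k$ such that $G$ together with $k$ new isolated vertices is the competition graph of an acyclic digraph. For a positive integer $m$, $CP(m)$ is the complete multipartite graph with $m$ parts each of size two ($CP(1)$ is two nonadjacent vertices). A vertex-weighted graph $(H,f)$ is a graph $H$ with $f:V(H)\to\mathbb{Z}_{\ge0}$. The generalized line graph $L(H,f)$ is obtained from the disjoint union of the line graph $L(H)$ (vertex set $E(H)$, two distinct edges adjacent iff they share an endpoint) and the graphs $Q_v:=CP(f(v))$ for each $v$ with $f(v)>0$, by adding all edges between every vertex of $Q_v$ and every $e\in E(H)$ incident to $v$. -}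

module Defs where

open import Data.Empty using (⊥-elim-irr)
open import Data.Fin.Base as Fin using (Fin; zero; suc)
open import Data.Fin.Properties as Fin using (+↔⊎; *↔×; any?)
open import Data.Irrelevant using (Irrelevant; [_])
open import Data.Nat.Base using (ℕ; zero; suc; _+_; _*_; _≤_)
open import Data.Product.Base using (Σ; ∃; ∃-syntax; _×_; _,_; proj₁; proj₂)
open import Data.Product.Function.Dependent.Propositional using (Σ-↔)
open import Data.Product.Function.NonDependent.Propositional using (_×-cong_)
open import Data.Sum.Base using (_⊎_; inj₁; inj₂)
open import Data.Sum.Function.Propositional using (_⊎-cong_)
open import Function.Base using (_∘_)
open import Function.Bundles using (_↔_; _⇔_; Inverse; mk↔ₛ′)
open import Function.Properties.Inverse using (↔-refl; ↔-sym; ↔-trans; ↔⇒↣)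
open import Level using (0ℓ)
open import Relation.Binary.Construct.Closure.ReflexiveTransitive using (Star)
open import Relation.Binary.Construct.Closure.Transitive using (TransClosure)
open import Relation.Binary.Core using (Rel)
open import Relation.Binary.Definitions
  using (Decidable; DecidableEquality; Symmetric; Irreflexive)
open import Relation.Binary.PropositionalEquality
  using (_≡_; _≢_; refl; sym; subst)
open import Relation.Nullary using (¬_; Dec; yes; no; ¬?)
open import Relation.Nullary.Decidable as Dec using (_×-dec_; _⊎-dec_)

------------------------------------------------------------------------
-- Finite types

Finite : Set → Set
Finite A = ∃[ n ] A ↔ Fin n

module _ {A : Set} (fin : Finite A) where

  index : A → Fin (proj₁ fin)
  index = Inverse.to (proj₂ fin)

  finite-≟ : DecidableEquality A
  finite-≟ = Fin.inj⇒≟ (↔⇒↣ (proj₂ fin))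

  finite-∃? : {P : A → Set} → (∀ a → Dec (P a)) → Dec (∃ P)
  finite-∃? {P} P? = Dec.map′
    (λ (i , p) → from i , p)
    (λ (a , p) → to a , subst P (sym (strictlyInverseʳ a)) p)
    (any? (P? ∘ from))
    where open Inverse (proj₂ fin)

finite-Fin : ∀ n → Finite (Fin n)
finite-Fin n = n , ↔-refl

finite-↔ : ∀ {A B} → A ↔ B → Finite B → Finite A
finite-↔ A↔B (n , B↔) = n , ↔-trans A↔B B↔

finite-⊎ : ∀ {A B} → Finite A → Finite B → Finite (A ⊎ B)
finite-⊎ (m , A↔) (n , B↔) = m + n , ↔-trans (A↔ ⊎-cong B↔) (↔-sym +↔⊎)

finite-× : ∀ {A B} → Finite A → Finite B → Finite (A × B)
finite-× (m , A↔) (n , B↔) = m * n , ↔-trans (A↔ ×-cong B↔) (↔-sym *↔×)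

finite-ΣFin : ∀ n {B : Fin n → Set} → (∀ i → Finite (B i)) → Finite (Σ (Fin n) B)
finite-ΣFin zero    finB = 0 , mk↔ₛ′ proj₁ (λ ()) (λ ()) (λ ())
finite-ΣFin (suc n) {B} finB =
  finite-↔ split (finite-⊎ (finB zero) (finite-ΣFin n (finB ∘ suc)))
  where
  split : Σ (Fin (suc n)) B ↔ (B zero ⊎ Σ (Fin n) (B ∘ suc))
  split = mk↔ₛ′
    (λ { (zero , b) → inj₁ b ; (suc i , b) → inj₂ (i , b) })
    (λ { (inj₁ b) → zero , b ; (inj₂ (i , b)) → suc i , b })
    (λ { (inj₁ b) → refl ; (inj₂ _) → refl })
    (λ { (zero , b) → refl ; (suc i , b) → refl })

finite-Σ : ∀ {A} {B : A → Set} → Finite A → (∀ a → Finite (B a)) → Finite (Σ A B)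
finite-Σ {A} {B} (n , A↔) finB =
  finite-↔ (↔-sym (Σ-↔ (↔-sym A↔) ↔-refl)) (finite-ΣFin n (finB ∘ Inverse.from A↔))

finite-Irrelevant : ∀ {P} → Dec P → Finite (Irrelevant P)
finite-Irrelevant (yes p) = 1 , mk↔ₛ′ (λ _ → zero) (λ _ → [ p ]) (λ { zero → refl }) (λ _ → refl)
finite-Irrelevant (no ¬p) = 0 , mk↔ₛ′
  (λ { [ p ] → ⊥-elim-irr (¬p p) })
  (λ ())
  (λ ())
  (λ { [ p ] → ⊥-elim-irr (¬p p) })

------------------------------------------------------------------------
-- Graphs

record Graph : Set₁ where
  field
    Vertex     : Set
    finite     : Finite Vertex
    Adj        : Rel Vertex 0ℓ
    adj?       : Decidable Adj
    adj-sym    : Symmetric Adj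
    adj-irrefl : Irreflexive _≡_ Adj

  _≟_ : DecidableEquality Vertex
  _≟_ = finite-≟ finite

open Graph using (Vertex; Adj)

Connected : Graph → Set
Connected G = ∀ u v → Star (Adj G) u v

record _≅_ (G H : Graph) : Set where
  field
    vertices : Vertex G ↔ Vertex H
    adjacent : ∀ u v → Adj G u v ⇔ Adj H (Inverse.to vertices u) (Inverse.to vertices v)

module _ (G : Graph) (k : ℕ) where

  data IsolatedAdj : Rel (Vertex G ⊎ Fin k) 0ℓ where
    old : ∀ {u v} → Adj G u v → IsolatedAdj (inj₁ u) (inj₁ v)

  addIsolated : Graph
  addIsolated = record
    { Vertex     = Vertex G ⊎ Fin k
    ; finite     = finite-⊎ G.finite (finite-Fin k)
    ; Adj        = IsolatedAdj
    ; adj?       = λ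
      { (inj₁ u) (inj₁ v) → Dec.map′ old (λ { (old a) → a }) (G.adj? u v)
      ; (inj₁ u) (inj₂ _) → no λ ()
      ; (inj₂ _) _        → no λ ()
      }
    ; adj-sym    = λ { (old a) → old (G.adj-sym a) }
    ; adj-irrefl = λ { refl (old a) → G.adj-irrefl refl a }
    }
    where module G = Graph G

------------------------------------------------------------------------
-- Digraphs and competition numbers

record Digraph : Set₁ where
  field
    Vertex : Set
    finite : Finite Vertex
    Arc    : Rel Vertex 0ℓ
    arc?   : Decidable Arc

Acyclic : Digraph → Set
Acyclic D = ∀ x → ¬ TransClosure (Digraph.Arc D) x x

competitionGraph : Digraph → Graph
competitionGraph D = record
  { Vertex     = D.Vertex
  ; finite     = D.finite
  ; Adj        = λ u v → u ≢ v × ∃[ x ] (D.Arc u x × D.Arc v x)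
  ; adj?       = λ u v → ¬? (finite-≟ D.finite u v)
               ×-dec finite-∃? D.finite (λ x → D.arc? u x ×-dec D.arc? v x)
  ; adj-sym    = λ (u≢v , x , ux , vx) → (u≢v ∘ sym) , x , vx , ux
  ; adj-irrefl = λ u≡v (u≢v , _) → u≢v u≡v
  }
  where module D = Digraph D

IsCompetitionGraphWith : Graph → ℕ → Set₁
IsCompetitionGraphWith G k =
  Σ Digraph λ D → Acyclic D × (addIsolated G k ≅ competitionGraph D)

-- k(G) = k, with the minimum expressed as a relation so that no search for the
-- least such k has to be carried out.
CompetitionNumber : Graph → ℕ → Set₁
CompetitionNumber G k =
  IsCompetitionGraphWith G k × (∀ j → IsCompetitionGraphWith G j → k ≤ j)

------------------------------------------------------------------------
-- Generalized line graphs

-- Two vertices are in the same part iff their first components agree;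
-- CP 0 is the empty graph.
CP : ℕ → Graph
CP m = record
  { Vertex     = Fin m × Fin 2
  ; finite     = finite-× (finite-Fin m) (finite-Fin 2)
  ; Adj        = λ p q → proj₁ p ≢ proj₁ q
  ; adj?       = λ p q → ¬? (proj₁ p Fin.≟ proj₁ q)
  ; adj-sym    = λ i≢j → i≢j ∘ sym
  ; adj-irrefl = λ { refl i≢i → i≢i refl }
  }

module _ (H : Graph) where
  private module H = Graph H

  -- An unordered pair {u , v} is represented once, with its ends listed in the
  -- order of the enumeration of vertices. The proofs are irrelevant, so edges
  -- are equal as soon as their ends are.
  record Edge : Set where
    constructor edge
    field
      end₁ end₂ : H.Vertex
      .ordered  : index H.finite end₁ Fin.< index H.finite end₂
      .adjacent : H.Adj end₁ end₂

  open Edge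

  Incident : H.Vertex → Edge → Set
  Incident v e = v ≡ end₁ e ⊎ v ≡ end₂ e

  incident? : Decidable Incident
  incident? v e = (v H.≟ end₁ e) ⊎-dec (v H.≟ end₂ e)

  finite-Edge : Finite Edge
  finite-Edge = finite-↔ pairs
    (finite-Σ (finite-× H.finite H.finite) λ (u , v) →
      finite-Irrelevant ((index H.finite u Fin.<? index H.finite v) ×-dec H.adj? u v))
    where
    pairs : Edge ↔ Σ (H.Vertex × H.Vertex) λ (u , v) →
              Irrelevant (index H.finite u Fin.< index H.finite v × H.Adj u v)
    pairs = mk↔ₛ′
      (λ { (edge u v o a) → (u , v) , [ o , a ] })
      (λ { ((u , v) , [ p ]) → edge u v (proj₁ p) (proj₂ p) })
      (λ _ → refl) (λ _ → refl)

  lineGraph : Graph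
  lineGraph = record
    { Vertex     = Edge
    ; finite     = finite-Edge
    ; Adj        = λ e e′ → e ≢ e′ × ∃[ v ] (Incident v e × Incident v e′)
    ; adj?       = λ e e′ → ¬? (finite-≟ finite-Edge e e′)
                 ×-dec finite-∃? H.finite (λ v → incident? v e ×-dec incident? v e′)
    ; adj-sym    = λ (e≢e′ , v , i , i′) → (e≢e′ ∘ sym) , v , i′ , i
    ; adj-irrefl = λ e≡e′ (e≢e′ , _) → e≢e′ e≡e′
    }

module _ (H : Graph) (f : Vertex H → ℕ) where
  private
    module H = Graph H
    module L = Graph (lineGraph H)
    module Q (v : Vertex H) = Graph (CP (f v))

  GLVertex : Set
  GLVertex = Vertex (lineGraph H) ⊎ Σ (Vertex H) λ v → Vertex (CP (f v))

  data GLAdj : Rel GLVertex 0ℓ where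
    line-line : ∀ {e e′} → Adj (lineGraph H) e e′ → GLAdj (inj₁ e) (inj₁ e′)
    CP-CP     : ∀ {v p q} → Adj (CP (f v)) p q → GLAdj (inj₂ (v , p)) (inj₂ (v , q))
    line-CP   : ∀ {e v p} → Incident H v e → GLAdj (inj₁ e) (inj₂ (v , p))
    CP-line   : ∀ {e v p} → Incident H v e → GLAdj (inj₂ (v , p)) (inj₁ e)

  GLAdj? : Decidable GLAdj
  GLAdj? (inj₁ e) (inj₁ e′) =
    Dec.map′ line-line (λ { (line-line a) → a }) (L.adj? e e′)
  GLAdj? (inj₁ e) (inj₂ (v , p)) =
    Dec.map′ line-CP (λ { (line-CP i) → i }) (incident? H v e)
  GLAdj? (inj₂ (v , p)) (inj₁ e) =
    Dec.map′ CP-line (λ { (CP-line i) → i }) (incident? H v e)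
  GLAdj? (inj₂ (v , p)) (inj₂ (w , q)) with v H.≟ w
  ... | yes refl = Dec.map′ CP-CP (λ { (CP-CP a) → a }) (Q.adj? v p q)
  ... | no  v≢w  = no λ { (CP-CP _) → v≢w refl }

  generalizedLineGraph : Graph
  generalizedLineGraph = record
    { Vertex     = GLVertex
    ; finite     = finite-⊎ L.finite (finite-Σ H.finite λ v → Q.finite v)
    ; Adj        = GLAdj
    ; adj?       = GLAdj?
    ; adj-sym    = λ
      { (line-line a)     → line-line (L.adj-sym a)
      ; (CP-CP {v} {p} {q} a) → CP-CP (Q.adj-sym v {p} {q} a)
      ; (line-CP i)       → CP-line i
      ; (CP-line i)       → line-CP i
      }
    ; adj-irrefl = λ
      { refl (line-line a) → L.adj-irrefl refl a
      ; refl (CP-CP {v} {p} a) → Q.adj-irrefl v {p} refl a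
      }
    }

{-# OPTIONS --safe #-}
module Submission where

-- At least one isolated vertex is needed because an acyclic digraph has a sink,
-- which is isolated in the competition graph, while L(H,f) has no isolated vertex.
--
-- One is enough: order V(H) so that every vertex but the first is adjacent to an
-- earlier one, the first vertex r has f(r) = 1 and, in case (i), so has the second.
-- Write E(w) for the edges at w and {a_j , b_j} for the parts of Q_w. The cliques
-- chosen at w are E(w) ∪ {b_j : all j}, S_k = E(w) ∪ {b_k} ∪ {a_i : i ≠ k} for
-- k < f(w), and S_f(w) = E(w) ∪ {a_i : all i}; they cover all edges. Every clique
-- gets a prey of its own, lower than all its members in a suitable ranking:
--   * S_(k+1) preys on b_k;
--   * the first clique at w preys on the new vertex if w = r, on a vertex a of r if
--     w is second, and otherwise on an edge from the predecessor of w to an earlier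
--     vertex;
--   * S_0, needed only if f(w) ≥ 2, preys on a vertex a of the last vertex of nonzero
--     weight before w, which in case (i) is never r.

open import Defs
open import Data.Empty using (⊥)
open import Data.Fin.Base as Fin using (Fin; zero; suc; toℕ; fromℕ; fromℕ<)
import Data.Fin.Properties as Fin
open import Data.Nat.Base using (ℕ; zero; suc; pred; _+_; _⊔_; _≤_; _<_; z≤n; s≤s)
import Data.Nat.Properties as ℕ
open import Data.Product.Base using (Σ; ∃; ∃₂; ∃-syntax; _×_; _,_; proj₁; proj₂)
open import Data.Product.Properties using (≡-dec)
open import Data.Product.Relation.Binary.Lex.Strict using (×-Lex; ×-transitive)
open import Data.Sum.Base using (_⊎_; inj₁; inj₂; [_,_]′)
open import Function.Base using (_∘_)
open import Function.Bundles using (Inverse; Equivalence; Injection; mk⇔)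
open import Function.Properties.Inverse using (↔-refl; ↔⇒↣)
open import Level using (0ℓ)
open import Relation.Binary.Construct.Closure.ReflexiveTransitive using (Star; ε; _◅_)
open import Relation.Binary.Construct.Closure.Transitive using (TransClosure; [_]; _∷_; _∷ʳ_)
open import Relation.Binary.Core using (Rel; REL)
open import Relation.Binary.Definitions using (Decidable; Transitive; tri<; tri≈; tri>)
open import Relation.Binary.PropositionalEquality
  using (_≡_; _≢_; refl; sym; trans; cong; subst; isEquivalence; resp₂)
open import Relation.Nullary using (¬_; Dec; yes; no; ¬?; contradiction)
open import Relation.Nullary.Decidable using (_×-dec_; _→-dec_; decidable-stable)

open Graph using (Vertex; Adj)

-- Walks, sinks and the lower bound

crossing : ∀ {V : Set} {R : Rel V 0ℓ} {P : V → Set} → (∀ x → Dec (P x)) →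
           ∀ {x y} → P x → ¬ P y → Star R x y → ∃₂ λ a b → P a × ¬ P b × R a b
crossing P? px ¬py ε = contradiction px ¬py
crossing P? px ¬py (_◅_ {j = z} r rs) with P? z
... | yes pz = crossing P? pz ¬py rs
... | no ¬pz = _ , _ , px , ¬pz , r

-- Following out-arcs from `start` gives an endless walk. By the pigeonhole principle it revisits a
-- vertex, and the stretch between two visits is a cycle.
acyclic⇒¬serial : (D : Digraph) → Acyclic D → Digraph.Vertex D →
                  ¬ (∀ x → ∃ (Digraph.Arc D x))
acyclic⇒¬serial D acyclic start next = acyclic (walk (toℕ i)) cycle
  where
  open Digraph D using (finite; Arc)
  walk : ℕ → Digraph.Vertex D
  walk zero    = start
  walk (suc i) = proj₁ (next (walk i))

  path : ∀ {i j} → i < j → TransClosure Arc (walk i) (walk j)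
  path {i} {suc j} (s≤s i≤j) with ℕ.m≤n⇒m<n∨m≡n i≤j
  ... | inj₁ i<j  = path i<j ∷ʳ proj₂ (next (walk j))
  ... | inj₂ refl = [ proj₂ (next (walk i)) ]

  collision = Fin.pigeonhole (ℕ.n<1+n (proj₁ finite)) (index finite ∘ walk ∘ toℕ)
  i = proj₁ collision
  j = proj₁ (proj₂ collision)
  i<j = proj₁ (proj₂ (proj₂ collision))
  same = Injection.injective (↔⇒↣ (proj₂ finite)) (proj₂ (proj₂ (proj₂ collision)))

  cycle : TransClosure Arc (walk (toℕ i)) (walk (toℕ i))
  cycle = subst (TransClosure Arc _) (sym same) (path i<j)

-- With no new vertex, every vertex of the digraph corresponds to one with a neighbour, so it has an
-- out-arc to their common prey.
noIsolated⇒k≥1 : (G : Graph) → Vertex G → (∀ x → ∃ (Adj G x)) →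
                 ∀ k → IsCompetitionGraphWith G k → 1 ≤ k
noIsolated⇒k≥1 G x₀ neighbour (suc k) _ = s≤s z≤n
noIsolated⇒k≥1 G x₀ neighbour zero (D , acyclic , iso) =
  contradiction next (acyclic⇒¬serial D acyclic (to (inj₁ x₀)))
  where
  open _≅_ iso
  open Inverse vertices using (to; from; strictlyInverseˡ)
  next : ∀ x → ∃ (Digraph.Arc D x)
  next x with from x | strictlyInverseˡ x
  ... | inj₁ u | refl =
    let v , a = neighbour u
        _ , y , uy , _ = Equivalence.to (adjacent (inj₁ u) (inj₁ v)) (old a)
    in y , uy

-- Acyclic digraphs from clique covers

module CliqueCover
  (G : Graph) (k : ℕ) {K S : Set} (finite-K : Finite K)
  {_∈_ : REL (Vertex G) K 0ℓ} (_∈?_ : ∀ u κ → Dec (u ∈ κ))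
  {_↝_ : REL K (Vertex G ⊎ Fin k) 0ℓ} (_↝?_ : ∀ κ x → Dec (κ ↝ x))
  (clique : ∀ {κ u v} → u ∈ κ → v ∈ κ → u ≢ v → Adj G u v)
  (covered : ∀ {u v} → Adj G u v → ∃₂ λ κ x → u ∈ κ × v ∈ κ × κ ↝ x)
  (↝-injective : ∀ {κ κ′ x} → κ ↝ x → κ′ ↝ x → κ ≡ κ′)
  (rank : Vertex G ⊎ Fin k → S) {_≺_ : Rel S 0ℓ}
  (≺-trans : Transitive _≺_) (≺-irrefl : ∀ {s} → ¬ (s ≺ s))
  (decreasing : ∀ {u κ x} → u ∈ κ → κ ↝ x → rank x ≺ rank (inj₁ u))
  where

  D : Digraph
  D = record
    { Vertex = Vertex G ⊎ Fin k
    ; finite = finite-⊎ (Graph.finite G) (finite-Fin k)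
    ; Arc    = Arc
    ; arc?   = arc?
    }
    where
    Arc : Rel (Vertex G ⊎ Fin k) 0ℓ
    Arc (inj₁ u) x = ∃[ κ ] (u ∈ κ × κ ↝ x)
    Arc (inj₂ _) x = ⊥

    arc? : Decidable Arc
    arc? (inj₁ u) x = finite-∃? finite-K λ κ → (u ∈? κ) ×-dec (κ ↝? x)
    arc? (inj₂ _) x = no λ ()

  open Digraph D using (Arc)

  arc-decreasing : ∀ {u x} → Arc u x → rank x ≺ rank u
  arc-decreasing {inj₁ u} (κ , u∈κ , κ↝x) = decreasing u∈κ κ↝x

  path-decreasing : ∀ {u x} → TransClosure Arc u x → rank x ≺ rank u
  path-decreasing [ a ]   = arc-decreasing a
  path-decreasing (a ∷ p) = ≺-trans (path-decreasing p) (arc-decreasing a)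

  to : ∀ u v → Adj (addIsolated G k) u v → Adj (competitionGraph D) u v
  to _ _ (old {u} {v} a) =
    let κ , x , u∈κ , v∈κ , κ↝x = covered a in
    (λ { refl → Graph.adj-irrefl G refl a }) , x , (κ , u∈κ , κ↝x) , (κ , v∈κ , κ↝x)

  from : ∀ u v → Adj (competitionGraph D) u v → Adj (addIsolated G k) u v
  from (inj₁ u) (inj₁ v) (u≢v , x , (κ , u∈κ , κ↝x) , (κ′ , v∈κ′ , κ′↝x))
    with refl ← ↝-injective κ↝x κ′↝x = old (clique u∈κ v∈κ′ (u≢v ∘ cong inj₁))

  -- Common prey forces a common clique by `↝-injective`, hence adjacency; the cover gives the
  -- converse. New vertices have no prey, so they stay isolated. Ranks fall along arcs, which
  -- excludes cycles.
  isCompetitionGraphWith : IsCompetitionGraphWith G k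
  isCompetitionGraphWith = D , (λ x p → ≺-irrefl (path-decreasing p)) , record
    { vertices = ↔-refl ; adjacent = λ u v → mk⇔ (to u v) (from u v) }

-- The triple (level , kind , number), ordered lexicographically, both ranks the
-- vertices of the digraph and identifies the possible preys of a clique.
Slot : Set
Slot = ℕ × ℕ × ℕ

_≺_ : Rel Slot 0ℓ
_≺_ = ×-Lex _≡_ _<_ (×-Lex _≡_ _<_ _<_)

≺-trans : Transitive _≺_
≺-trans {x} {y} {z} =
  ×-transitive {_<₂_ = ×-Lex _≡_ _<_ _<_} isEquivalence (resp₂ _<_) ℕ.<-trans
    (λ {x} {y} {z} →
      ×-transitive {_<₂_ = _<_} isEquivalence (resp₂ _<_) ℕ.<-trans ℕ.<-trans {x} {y} {z})
    {x} {y} {z}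

≺-irrefl : ∀ {s} → ¬ (s ≺ s)
≺-irrefl (inj₁ l<l)                       = ℕ.<-irrefl refl l<l
≺-irrefl (inj₂ (_ , inj₁ k<k))            = ℕ.<-irrefl refl k<k
≺-irrefl (inj₂ (_ , inj₂ (_ , j<j)))      = ℕ.<-irrefl refl j<j

-- Edges and the absence of isolated vertices

module _ (H : Graph) where
  private module H = Graph H
  open Edge using (end₁; end₂)

  toEdge : ∀ {u v} → H.Adj u v →
           Σ (Edge H) λ e → (end₁ e ≡ u × end₂ e ≡ v) ⊎ (end₁ e ≡ v × end₂ e ≡ u)
  toEdge {u} {v} a with Fin.<-cmp (index H.finite u) (index H.finite v)
  ... | tri< lt _ _ = edge u v lt a , inj₁ (refl , refl)
  ... | tri> _ _ gt = edge v u gt (H.adj-sym a) , inj₂ (refl , refl)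
  ... | tri≈ _ eq _ =
    contradiction a (H.adj-irrefl (Injection.injective (↔⇒↣ (proj₂ H.finite)) eq))

  incidentEdge : ∀ {u v} → H.Adj u v → ∃[ e ] (Incident H u e × Incident H v e)
  incidentEdge a with toEdge a
  ... | e , inj₁ (refl , refl) = e , inj₁ refl , inj₂ refl
  ... | e , inj₂ (refl , refl) = e , inj₂ refl , inj₁ refl

  connected⇒incident : Connected H → Edge H → ∀ v → ∃ (Incident H v)
  connected⇒incident connected e₀ v with connected v (end₁ e₀)
  ... | ε     = e₀ , inj₁ refl
  ... | a ◅ _ = let e , v∈e , _ = incidentEdge a in e , v∈e

  GL-noIsolated : (f : H.Vertex → ℕ) → Connected H → Edge H → ∀ {w} → 0 < f w →
                  ∀ x → ∃ (GLAdj H f x)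
  GL-noIsolated f connected e₀ {w} 0<fw (inj₂ (v , _)) =
    let e , v∈e = connected⇒incident connected e₀ v in inj₁ e , CP-line v∈e
  GL-noIsolated f connected e₀ {w} 0<fw (inj₁ e) with incident? H w e
  ... | yes w∈e = inj₂ (w , fromℕ< 0<fw , zero) , line-CP w∈e
  ... | no w∉e =
    -- A walk from an end of `e` to `w` must leave the ends of `e`; the edge along which it does so
    -- is a neighbour of `e`.
    let x , y , x∈e , y∉e , a = crossing (λ v → incident? H v e) (inj₁ refl) w∉e
                                  (connected (end₁ e) w)
        e′ , x∈e′ , y∈e′ = incidentEdge a
    in inj₁ e′ , line-line ((λ e≡e′ → y∉e (subst (Incident H y) (sym e≡e′) y∈e′)) , x , x∈e , x∈e′)

  -- Search orders of a connected graph

  record SearchOrder : Set where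
    field
      at       : ℕ → H.Vertex
      pos      : H.Vertex → ℕ
      at-pos   : ∀ w → at (pos w) ≡ w
      -- The bound `i ≤ pos w` certifies that `i` is a genuine position; beyond the last one `at` is
      -- arbitrary.
      pos-at   : ∀ {w i} → i ≤ pos w → pos (at i) ≡ i
      attached : ∀ {w i} → pos w ≡ suc i → ∃[ v ] (H.Adj w v × pos v ≤ i)

    pos-injective : ∀ {v w} → pos v ≡ pos w → v ≡ w
    pos-injective {v} {w} eq = trans (sym (at-pos v)) (trans (cong at eq) (at-pos w))

  record Prefix (n : ℕ) : Set where
    field
      nth           : ℕ → H.Vertex
      nth-injective : ∀ {i j} → i < n → j < n → nth i ≡ nth j → i ≡ j
      nth-attached  : ∀ {i} → suc i < n → ∃[ j ] (j ≤ i × H.Adj (nth (suc i)) (nth j))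

  open Prefix

  Reached : ∀ {n} → Prefix n → H.Vertex → Set
  Reached {n} p w = ∃[ i ] (nth p (toℕ {n} i) ≡ w)

  reached? : ∀ {n} (p : Prefix n) w → Dec (Reached p w)
  reached? p w = Fin.any? λ i → nth p (toℕ i) H.≟ w

  prefix-bound : ∀ {n} → Prefix n → n ≤ proj₁ H.finite
  prefix-bound {n} p = Fin.injective⇒≤ {f = index H.finite ∘ nth p ∘ toℕ} λ {i} {j} eq →
    Fin.toℕ-injective (nth-injective p (Fin.toℕ<n i) (Fin.toℕ<n j)
      (Injection.injective (↔⇒↣ (proj₂ H.finite)) eq))

  Agree : ∀ {m n} → Prefix m → Prefix n → Set
  Agree {m} p q = ∀ {i} → i < m → nth q i ≡ nth p i

  module _ {n} (p : Prefix n) {j : Fin n} {c} (c∉p : ¬ Reached p c)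
           (a : H.Adj (nth p (toℕ j)) c) where
    private
      nth⁺ : ℕ → H.Vertex
      nth⁺ i with i ℕ.≟ n
      ... | yes _ = c
      ... | no  _ = nth p i

      nth⁺-new : nth⁺ n ≡ c
      nth⁺-new with n ℕ.≟ n
      ... | yes _  = refl
      ... | no n≢n = contradiction refl n≢n

      nth⁺-old : ∀ {i} → i < n → nth⁺ i ≡ nth p i
      nth⁺-old {i} i<n with i ℕ.≟ n
      ... | yes refl = contradiction i<n (ℕ.<-irrefl refl)
      ... | no  _    = refl

      fresh : ∀ {i} → i < n → nth⁺ i ≢ nth⁺ n
      fresh i<n eq = c∉p (fromℕ< i<n ,
        trans (cong (nth p) (Fin.toℕ-fromℕ< i<n)) (trans (sym (nth⁺-old i<n)) (trans eq nth⁺-new)))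

      injective : ∀ {i k} → i < suc n → k < suc n → nth⁺ i ≡ nth⁺ k → i ≡ k
      injective (s≤s i≤n) (s≤s k≤n) eq
        with ℕ.m≤n⇒m<n∨m≡n i≤n | ℕ.m≤n⇒m<n∨m≡n k≤n
      ... | inj₁ i<n  | inj₁ k<n  =
        nth-injective p i<n k<n (trans (sym (nth⁺-old i<n)) (trans eq (nth⁺-old k<n)))
      ... | inj₁ i<n  | inj₂ refl = contradiction eq (fresh i<n)
      ... | inj₂ refl | inj₁ k<n  = contradiction (sym eq) (fresh k<n)
      ... | inj₂ refl | inj₂ refl = refl

      attached⁺ : ∀ {i} → suc i < suc n → ∃[ k ] (k ≤ i × H.Adj (nth⁺ (suc i)) (nth⁺ k))
      attached⁺ {i} (s≤s i<n) with ℕ.m≤n⇒m<n∨m≡n i<n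
      ... | inj₁ 1+i<n =
        let k , k≤i , b = nth-attached p 1+i<n in
        k , k≤i , subst (H.Adj _) (sym (nth⁺-old (ℕ.≤-<-trans k≤i i<n)))
                    (subst (λ x → H.Adj x _) (sym (nth⁺-old 1+i<n)) b)
      ... | inj₂ refl =
        toℕ j , ℕ.≤-pred (Fin.toℕ<n j) ,
        subst (H.Adj _) (sym (nth⁺-old (Fin.toℕ<n j)))
          (subst (λ x → H.Adj x _) (sym nth⁺-new) (H.adj-sym a))

    snoc : Σ (Prefix (suc n)) (Agree p)
    snoc = record { nth = nth⁺ ; nth-injective = injective ; nth-attached = attached⁺ } , nth⁺-old

  module _ (connected : Connected H) where

    -- A walk from the first vertex to a missing one crosses from the prefix to a new vertex, which
    -- can be appended.
    extend : ∀ {n} (p : Prefix (suc n)) →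
             (∀ w → Reached p w) ⊎ Σ (Prefix (suc (suc n))) (Agree p)
    extend p with finite-∃? H.finite (λ w → ¬? (reached? p w))
    ... | no allReached =
      inj₁ λ w → decidable-stable (reached? p w) λ ¬r → allReached (w , ¬r)
    ... | yes (w , w∉p) with crossing (reached? p) (zero , refl) w∉p (connected (nth p 0) w)
    ...   | _ , c , (j , refl) , c∉p , a = inj₂ (snoc p {j} c∉p a)

    -- The fuel bounds the extensions still possible: once it is gone `H` has at most `n` vertices,
    -- while a further extension would list `n + 2` distinct ones.
    exhaust : ∀ fuel {n} → proj₁ H.finite ≤ fuel + n → (p : Prefix (suc n)) →
              ∃[ m ] Σ (Prefix m) λ q → (∀ w → Reached q w) × Agree p q
    exhaust fuel N≤ p with extend p
    exhaust fuel N≤ p | inj₁ reached = _ , p , reached , λ _ → refl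
    exhaust zero N≤ p | inj₂ (q , _) =
      contradiction (ℕ.≤-trans (prefix-bound q) N≤) (ℕ.<⇒≱ (ℕ.m≤n⇒m≤1+n ℕ.≤-refl))
    exhaust (suc fuel) {n} N≤ p | inj₂ (q , p⊑q) =
      let m , r , reached , q⊑r = exhaust fuel (subst (proj₁ H.finite ≤_) (sym (ℕ.+-suc fuel n)) N≤) q in
      m , r , reached , λ i<n → trans (q⊑r (ℕ.m≤n⇒m≤1+n i<n)) (p⊑q i<n)

    -- Starting from `p` is what lets the first one or two vertices be prescribed.
    searchOrder : ∀ {n} (p : Prefix (suc n)) →
                  Σ SearchOrder λ o → ∀ {i} → i < suc n → SearchOrder.at o i ≡ nth p i
    searchOrder {n} p with exhaust (proj₁ H.finite) (ℕ.m≤m+n _ n) p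
    ... | m , q , reached , p⊑q = record
      { at = nth q ; pos = pos ; at-pos = at-pos
      ; pos-at = λ {w} i≤ → pos-at (ℕ.≤-<-trans i≤ (pos<m w)) ; attached = parent } , p⊑q
      where
      pos : H.Vertex → ℕ
      pos w = toℕ (proj₁ (reached w))
      pos<m : ∀ w → pos w < m
      pos<m w = Fin.toℕ<n (proj₁ (reached w))
      at-pos : ∀ w → nth q (pos w) ≡ w
      at-pos w = proj₂ (reached w)
      pos-at : ∀ {i} → i < m → pos (nth q i) ≡ i
      pos-at i<m = nth-injective q (pos<m _) i<m (at-pos _)
      parent : ∀ {w i} → pos w ≡ suc i → ∃[ v ] (H.Adj w v × pos v ≤ i)
      parent {w} {i} eq with nth-attached q (subst (_< m) eq (pos<m w))
      ... | j , j≤i , a =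
        nth q j , subst (λ x → H.Adj x _) (trans (cong (nth q) (sym eq)) (at-pos w)) a ,
        subst (_≤ i) (sym (pos-at (ℕ.≤-<-trans j≤i
          (ℕ.<-trans (ℕ.n<1+n i) (subst (_< m) eq (pos<m w)))))) j≤i

  -- Cliques, preys and ranks

  module Construction (f : H.Vertex → ℕ) (order : SearchOrder) where
    open SearchOrder order

    -- The last position before i that carries a nonzero weight (0 if there is none).
    recent : ℕ → ℕ
    recent zero    = 0
    recent (suc i) with f (at i)
    ... | zero  = recent i
    ... | suc _ = i

    recent-≤ : ∀ i → recent i ≤ pred i
    recent-≤ zero    = z≤n
    recent-≤ (suc i) with f (at i)
    ... | zero  = ℕ.≤-trans (recent-≤ i) ℕ.pred[n]≤n
    ... | suc _ = ℕ.≤-refl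

    recent-≥ : ∀ {i j} → i < j → 0 < f (at i) → i ≤ recent j
    recent-≥ {i} {suc j} (s≤s i≤j) 0<f with f (at j) in eq
    ... | suc _ = i≤j
    ... | zero with ℕ.m≤n⇒m<n∨m≡n i≤j
    ...   | inj₁ i<j  = recent-≥ i<j 0<f
    ...   | inj₂ refl = contradiction 0<f (ℕ.<-irrefl (sym eq))

    recent-nonzero : ∀ {i j} → i < j → 0 < f (at i) → 0 < f (at (recent j))
    recent-nonzero {i} {suc j} (s≤s i≤j) 0<f with f (at j) in eq
    ... | suc _ = subst (0 <_) (sym eq) (s≤s z≤n)
    ... | zero with ℕ.m≤n⇒m<n∨m≡n i≤j
    ...   | inj₁ i<j  = recent-nonzero i<j 0<f
    ...   | inj₂ refl = contradiction 0<f (ℕ.<-irrefl (sym eq))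

    private
      G = generalizedLineGraph H f

    level : H.Vertex → ℕ
    level w = suc (pos w)

    -- The later end decides the level of an edge. Within a level, edges rank above the a's and
    -- these above the b's; level 0 is left to the new vertex.
    slot : Vertex G ⊎ Fin 1 → Slot
    slot (inj₁ (inj₁ e))                    = suc (pos (end₁ e) ⊔ pos (end₂ e)) , 2 , 0
    slot (inj₁ (inj₂ (w , j , zero)))       = level w , 1 , 0
    slot (inj₁ (inj₂ (w , j , suc zero)))   = level w , 0 , toℕ j
    slot (inj₂ _)                           = 0 , 0 , 0

    -- (w , zero) is the clique with all b_j, and (w , suc k) is S_k.
    Clique : Set
    Clique = Σ H.Vertex λ w → Fin (2 + f w)

    -- The part elements (i , 0) and (i , 1) are a_i and b_i.
    InPart : ∀ {m} → Fin m × Fin 2 → Fin (2 + m) → Set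
    InPart (_ , s)        zero    = s ≡ suc zero
    InPart (i , zero)     (suc k) = toℕ i ≢ toℕ k
    InPart (i , suc zero) (suc k) = toℕ i ≡ toℕ k

    inPart? : ∀ {m} (q : Fin m × Fin 2) k → Dec (InPart q k)
    inPart? (_ , s)        zero    = s Fin.≟ suc zero
    inPart? (i , zero)     (suc k) = ¬? (toℕ i ℕ.≟ toℕ k)
    inPart? (i , suc zero) (suc k) = toℕ i ℕ.≟ toℕ k

    data _∈_ : REL (Vertex G) Clique 0ℓ where
      line : ∀ {w e k} → Incident H w e → inj₁ e ∈ (w , k)
      part : ∀ {w q k} → InPart q k → inj₂ (w , q) ∈ (w , k)

    _∈?_ : ∀ u κ → Dec (u ∈ κ)
    inj₁ e ∈? (w , k) with incident? H w e
    ... | yes w∈e = yes (line w∈e)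
    ... | no  w∉e = no λ { (line w∈e) → w∉e w∈e }
    inj₂ (v , q) ∈? (w , k) with v H.≟ w
    ... | no v≢w = no λ { (part _) → v≢w refl }
    ... | yes refl with inPart? q k
    ...   | yes i = yes (part i)
    ...   | no ¬i = no λ { (part i) → ¬i i }

    clique : ∀ {κ u v} → u ∈ κ → v ∈ κ → u ≢ v → GLAdj H f u v
    clique (line {w} i) (line i′) u≢v = line-line (u≢v ∘ cong inj₁ , w , i , i′)
    clique (line i) (part _) u≢v = line-CP i
    clique (part _) (line i) u≢v = CP-line i
    clique {w , k} (part {q = q} i) (part {q = q′} i′) u≢v =
      CP-CP (distinct q q′ k i i′ (u≢v ∘ cong (λ q → inj₂ (w , q))))
      where
      -- A clique takes exactly one element from every part at its vertex.
      distinct : ∀ {m} (q q′ : Fin m × Fin 2) k → InPart q k → InPart q′ k → q ≢ q′ →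
                 proj₁ q ≢ proj₁ q′
      distinct (i , _) (_ , _) zero refl refl q≢q′ refl = q≢q′ refl
      distinct (i , zero) (_ , zero) (suc k) _ _ q≢q′ refl = q≢q′ refl
      distinct (i , zero) (_ , suc zero) (suc k) i≢k i≡k _ refl = i≢k i≡k
      distinct (i , suc zero) (_ , zero) (suc k) i≡k i≢k _ refl = i≢k i≡k
      distinct (i , suc zero) (_ , suc zero) (suc k) _ _ q≢q′ refl = q≢q′ refl

    -- The prey of the clique numbered 0 at a given position: the new vertex, an a of the first
    -- vertex, or an edge whose later end is the predecessor.
    starSlot : ℕ → Slot
    starSlot zero          = 0 , 0 , 0
    starSlot (suc zero)    = 1 , 1 , 0
    starSlot (suc (suc i)) = suc (suc i) , 2 , 0

    starSlot-level : ∀ i → proj₁ (starSlot i) ≡ i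
    starSlot-level zero          = refl
    starSlot-level (suc zero)    = refl
    starSlot-level (suc (suc i)) = refl

    target : Clique → Slot
    target (w , zero)        = starSlot (pos w)
    target (w , suc zero)    = suc (recent (pos w)) , 1 , 0
    target (w , suc (suc j)) = level w , 0 , toℕ j

    Used : Clique → Set
    Used (w , k) = toℕ k ≡ 1 → 2 ≤ f w

    -- A clique preys on everything in its target slot, which may hold several a's or several edges.
    -- This is harmless as long as used cliques have different targets.
    _↝_ : REL Clique (Vertex G ⊎ Fin 1) 0ℓ
    κ ↝ x = Used κ × slot x ≡ target κ

    _↝?_ : ∀ κ x → Dec (κ ↝ x)
    (w , k) ↝? x = ((toℕ k ℕ.≟ 1) →-dec (2 ℕ.≤? f w)) ×-dec
                   ≡-dec ℕ._≟_ (≡-dec ℕ._≟_ ℕ._≟_) (slot x) (target (w , k))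

    -- Preys are private, lower in rank, and present

    module _ (root : f (at 0) ≡ 1)
             -- The common form of both cases: in (i) the first two vertices have weight 1, in (ii)
             -- the condition is vacuous.
             (heavy : ∀ {w} → 2 ≤ f w → 2 ≤ pos w × 0 < f (at 1)) where

      -- Keeps S_0 off the a's of the first vertex, already the prey of the clique numbered 0 at the
      -- second.
      1≤recent : ∀ {w} → 2 ≤ f w → 1 ≤ recent (pos w)
      1≤recent 2≤f = let 2≤pos , 0<f₁ = heavy 2≤f in recent-≥ 2≤pos 0<f₁

      recent-< : ∀ {w} → 2 ≤ f w → recent (pos w) < pos w
      recent-< {w} 2≤f with pos w | proj₁ (heavy 2≤f) | recent-≤ (pos w)
      ... | suc _ | _ | r≤ = s≤s r≤

      -- The position of `v` itself carries nonzero weight and precedes `w`, so it separates the two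
      -- values.
      recent-mono : ∀ {v w} → 2 ≤ f v → 2 ≤ f w → pos v < pos w →
                    recent (pos v) < recent (pos w)
      recent-mono {v} 2≤fv 2≤fw v<w = ℕ.<-≤-trans (recent-< 2≤fv)
        (recent-≥ v<w (subst (0 <_) (cong f (sym (at-pos v))) (ℕ.<-trans (s≤s z≤n) 2≤fv)))

      recent-injective : ∀ {v w} → 2 ≤ f v → 2 ≤ f w →
                         recent (pos v) ≡ recent (pos w) → v ≡ w
      recent-injective {v} {w} 2≤fv 2≤fw eq with ℕ.<-cmp (pos v) (pos w)
      ... | tri< v<w _ _ = contradiction (recent-mono 2≤fv 2≤fw v<w) (ℕ.<-irrefl eq)
      ... | tri≈ _ v≡w _ = pos-injective v≡w
      ... | tri> _ _ w<v = contradiction (recent-mono 2≤fw 2≤fv w<v) (ℕ.<-irrefl (sym eq))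

      -- Only `starSlot 1` has kind 1, and its level would force `recent (pos w)` to be 0.
      starSlot≢recent : ∀ i {w} → 2 ≤ f w → starSlot i ≢ (suc (recent (pos w)) , 1 , 0)
      starSlot≢recent (suc zero) 2≤f eq =
        contradiction (1≤recent 2≤f) (ℕ.<-irrefl (ℕ.suc-injective (cong proj₁ eq)))

      starSlot≢part : ∀ i {l j} → starSlot i ≢ (suc l , 0 , j)
      starSlot≢part zero          ()
      starSlot≢part (suc zero)    ()
      starSlot≢part (suc (suc i)) ()

      target-injective : ∀ κ κ′ → Used κ → Used κ′ → target κ ≡ target κ′ → κ ≡ κ′
      target-injective (v , zero) (w , zero) _ _ eq
        with refl ← pos-injective {v} {w} (trans (sym (starSlot-level (pos v)))
                      (trans (cong proj₁ eq) (starSlot-level (pos w)))) = refl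
      target-injective (v , zero) (w , suc zero) _ u′ eq =
        contradiction eq (starSlot≢recent (pos v) (u′ refl))
      target-injective (v , zero) (w , suc (suc j)) _ _ eq =
        contradiction eq (starSlot≢part (pos v))
      target-injective (v , suc zero) (w , zero) u _ eq =
        contradiction (sym eq) (starSlot≢recent (pos w) (u refl))
      target-injective (v , suc zero) (w , suc zero) u u′ eq
        with refl ← recent-injective (u refl) (u′ refl)
                      (ℕ.suc-injective (cong proj₁ eq)) = refl
      target-injective (v , suc (suc i)) (w , zero) _ _ eq =
        contradiction (sym eq) (starSlot≢part (pos w))
      target-injective (v , suc (suc i)) (w , suc (suc j)) _ _ eq
        with refl ← pos-injective {v} {w} (ℕ.suc-injective (cong proj₁ eq))
        with refl ← Fin.toℕ-injective {i = i} {j} (cong (proj₂ ∘ proj₂) eq) = refl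

      incident⇒pos≤ : ∀ {w} e → Incident H w e → pos w ≤ pos (end₁ e) ⊔ pos (end₂ e)
      incident⇒pos≤ e (inj₁ refl) = ℕ.m≤m⊔n _ _
      incident⇒pos≤ e (inj₂ refl) = ℕ.m≤n⊔m _ _

      target-≺-line : ∀ {w} e k → Incident H w e → Used (w , k) →
                      target (w , k) ≺ slot (inj₁ (inj₁ e))
      target-≺-line {w} e zero w∈e _ =
        inj₁ (s≤s (subst (_≤ _) (sym (starSlot-level (pos w))) (incident⇒pos≤ e w∈e)))
      target-≺-line e (suc zero) w∈e u =
        inj₁ (s≤s (ℕ.≤-trans (recent-< (u refl)) (incident⇒pos≤ e w∈e)))
      target-≺-line e (suc (suc j)) w∈e _ with ℕ.m≤n⇒m<n∨m≡n (incident⇒pos≤ e w∈e)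
      ... | inj₁ w<e = inj₁ (s≤s w<e)
      -- Here `w` is the later end of `e`: the levels tie, and the kind of a b is below that of an
      -- edge.
      ... | inj₂ w≡e = inj₂ (cong suc w≡e , inj₁ (s≤s z≤n))

      slot-part-level : ∀ w q → proj₁ (slot (inj₁ (inj₂ (w , q)))) ≡ level w
      slot-part-level w (_ , zero)     = refl
      slot-part-level w (_ , suc zero) = refl

      target-≺-part : ∀ {w} q k → InPart q k → Used (w , k) →
                      target (w , k) ≺ slot (inj₁ (inj₂ (w , q)))
      target-≺-part {w} q zero _ _ = inj₁ (subst (_ <_) (sym (slot-part-level w q))
        (s≤s (ℕ.≤-reflexive (starSlot-level (pos w)))))
      target-≺-part {w} q (suc zero) _ u = inj₁ (subst (_ <_) (sym (slot-part-level w q))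
        (s≤s (recent-< (u refl))))
      target-≺-part (_ , zero) (suc (suc j)) _ _ = inj₂ (refl , inj₁ (s≤s z≤n))
      -- The only b in S_(j+1) is b_(j+1), numbered one above the prey b_j.
      target-≺-part (_ , suc zero) (suc (suc j)) i≡ _ =
        inj₂ (refl , inj₂ (refl , ℕ.≤-reflexive (sym i≡)))

      decreasing : ∀ {u κ x} → u ∈ κ → κ ↝ x → slot x ≺ slot (inj₁ u)
      decreasing (line {e = e} {k} i) (u , eq) =
        subst (_≺ _) (sym eq) (target-≺-line e k i u)
      decreasing (part {q = q} {k} i) (u , eq) =
        subst (_≺ _) (sym eq) (target-≺-part q k i u)

      ↝-injective : ∀ {κ κ′ x} → κ ↝ x → κ′ ↝ x → κ ≡ κ′
      ↝-injective (u , eq) (u′ , eq′) = target-injective _ _ u u′ (trans (sym eq) eq′)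

      star-occupied : ∀ {w} i → pos w ≡ i → ∃[ x ] (slot x ≡ starSlot i)
      star-occupied zero          _  = inj₂ zero , refl
      star-occupied {w} (suc zero) eq =
        inj₁ (inj₂ (at 0 , fromℕ< (ℕ.≤-reflexive (sym root)) , zero)) ,
        cong (λ i → suc i , 1 , 0) (pos-at {w} z≤n)
      star-occupied {w} (suc (suc i)) eq
        -- The vertex at position `suc i` is joined to an earlier one, so it is the later end of
        -- that edge.
        with pos-at {w} (ℕ.≤-trans (ℕ.n≤1+n (suc i)) (ℕ.≤-reflexive (sym eq)))
      ... | pos≡ with attached pos≡
      ...   | v , a , v≤i with ℕ.≤-trans v≤i (ℕ.≤-trans (ℕ.n≤1+n i) (ℕ.≤-reflexive (sym pos≡)))
      ...     | v≤ with toEdge a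
      ...       | e , inj₁ (refl , refl) =
        inj₁ (inj₁ e) , cong (λ l → suc l , 2 , 0) (trans (ℕ.m≥n⇒m⊔n≡m v≤) pos≡)
      ...       | e , inj₂ (refl , refl) =
        inj₁ (inj₁ e) , cong (λ l → suc l , 2 , 0) (trans (ℕ.m≤n⇒m⊔n≡n v≤) pos≡)

      occupied : ∀ κ → Used κ → ∃[ x ] (κ ↝ x)
      occupied (w , zero) u = let x , eq = star-occupied (pos w) refl in x , u , eq
      occupied (w , suc zero) u =
        let 2≤pos , 0<f₁ = heavy (u refl) in
        inj₁ (inj₂ (at (recent (pos w)) , fromℕ< (recent-nonzero 2≤pos 0<f₁) , zero)) , u ,
        cong (λ i → suc i , 1 , 0) (pos-at (ℕ.<⇒≤ (recent-< (u refl))))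
      occupied (w , suc (suc j)) u = inj₁ (inj₂ (w , j , suc zero)) , u , refl

      cover : ∀ {u v} κ → Used κ → u ∈ κ → v ∈ κ → ∃₂ λ κ x → u ∈ κ × v ∈ κ × κ ↝ x
      cover κ used u∈κ v∈κ = let x , κ↝x = occupied κ used in κ , x , u∈κ , v∈κ , κ↝x

      transversal : ∀ {m} → Fin m → Fin (2 + m)
      transversal k = suc (Fin.inject₁ k)

      allFirst : ∀ {m} → Fin (2 + m)
      allFirst {m} = fromℕ (suc m)

      allFirst-InPart : ∀ {m} (i : Fin m) → InPart (i , zero) (allFirst {m})
      allFirst-InPart {m} i eq = ℕ.<-irrefl (trans eq (Fin.toℕ-fromℕ m)) (Fin.toℕ<n i)

      -- If `f w` were 0, `allFirst` would be number 1, that is S_0; a part at `w` rules this out.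
      allFirst-Used : ∀ {w} → Fin (f w) → Used (w , allFirst)
      allFirst-Used {w} i eq with f w
      ... | suc m = contradiction (trans (sym (Fin.toℕ-fromℕ (2 + m))) eq) λ ()

      distinct⇒2≤ : ∀ {m} {i j : Fin m} → i ≢ j → 2 ≤ m
      distinct⇒2≤ {suc zero} {zero} {zero} i≢j = contradiction refl i≢j
      distinct⇒2≤ {suc (suc m)} _ = s≤s (s≤s z≤n)

      -- S_0 can be called on only for a pair a_i, b_j with i ≠ j, and such a pair exhibits two
      -- parts, so S_0 is then used.
      covered : ∀ {u v} → GLAdj H f u v → ∃₂ λ κ x → u ∈ κ × v ∈ κ × κ ↝ x
      covered (line-line (_ , w , i , i′)) = cover (w , zero) (λ ()) (line i) (line i′)
      covered (line-CP {v = w} {j , zero} i) =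
        cover (w , allFirst) (allFirst-Used j) (line i) (part (allFirst-InPart j))
      covered (line-CP {v = w} {j , suc zero} i) =
        cover (w , zero) (λ ()) (line i) (part refl)
      covered (CP-line {v = w} {j , zero} i) =
        cover (w , allFirst) (allFirst-Used j) (part (allFirst-InPart j)) (line i)
      covered (CP-line {v = w} {j , suc zero} i) =
        cover (w , zero) (λ ()) (part refl) (line i)
      covered (CP-CP {w} {i , zero} {j , zero} _) =
        cover (w , allFirst) (allFirst-Used i) (part (allFirst-InPart i)) (part (allFirst-InPart j))
      covered (CP-CP {w} {i , suc zero} {j , suc zero} _) =
        cover (w , zero) (λ ()) (part refl) (part refl)
      covered (CP-CP {w} {i , suc zero} {j , zero} i≢j) =
        cover (w , transversal i) (λ _ → distinct⇒2≤ i≢j)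
          (part (sym (Fin.toℕ-inject₁ i)))
          (part λ eq → i≢j (sym (Fin.toℕ-injective (trans eq (Fin.toℕ-inject₁ i)))))
      covered (CP-CP {w} {i , zero} {j , suc zero} i≢j) =
        cover (w , transversal j) (λ _ → distinct⇒2≤ i≢j)
          (part λ eq → i≢j (Fin.toℕ-injective (trans eq (Fin.toℕ-inject₁ j))))
          (part (sym (Fin.toℕ-inject₁ j)))

      isCompetitionGraphWith₁ : IsCompetitionGraphWith G 1
      isCompetitionGraphWith₁ = CliqueCover.isCompetitionGraphWith G 1
        (finite-Σ H.finite λ w → finite-Fin (2 + f w))
        _∈?_ (λ κ x → κ ↝? x) clique covered
        (λ {κ} {κ′} {x} → ↝-injective {κ} {κ′} {x})
        slot (λ {x} {y} {z} → ≺-trans {x} {y} {z}) (λ {s} → ≺-irrefl {s})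
        (λ {u} {κ} {x} → decreasing {u} {κ} {x})

  -- Initial vertices and the two cases

  singletonPrefix : H.Vertex → Prefix 1
  singletonPrefix r = record
    { nth = λ _ → r
    ; nth-injective = λ { (s≤s z≤n) (s≤s z≤n) _ → refl }
    ; nth-attached = λ { (s≤s ()) }
    }

  edgePrefix : ∀ {u v} → H.Adj u v → Prefix 2
  edgePrefix {u} {v} a = record
    { nth = at′
    ; nth-injective = λ
      { {zero} {zero} _ _ _ → refl
      ; {zero} {suc zero} _ _ eq → contradiction a (H.adj-irrefl eq)
      ; {suc zero} {zero} _ _ eq → contradiction a (H.adj-irrefl (sym eq))
      ; {suc zero} {suc zero} _ _ _ → refl
      ; {suc (suc _)} (s≤s (s≤s ())) _ _
      ; {_} {suc (suc _)} _ (s≤s (s≤s ())) _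
      }
    ; nth-attached = λ
      { {zero} _ → 0 , z≤n , H.adj-sym a
      ; {suc _} (s≤s (s≤s ()))
      }
    }
    where
    at′ : ℕ → H.Vertex
    at′ zero    = u
    at′ (suc _) = v

  module _ (f : H.Vertex → ℕ) (connected : Connected H) where

    -- With `u` and `v` in the first two places, every vertex of weight at least 2 comes later.
    k≤1-edge : ∀ {u v} → H.Adj u v → f u ≡ 1 → f v ≡ 1 →
               IsCompetitionGraphWith (generalizedLineGraph H f) 1
    k≤1-edge {u} {v} a fu fv with searchOrder connected (edgePrefix a)
    ... | order , agree = isCompetitionGraphWith₁ f₀ heavy
      where
      open SearchOrder order using (pos; at-pos)
      open Construction f order
      f₀ = trans (cong f (agree {0} (s≤s z≤n))) fu
      f₁ = trans (cong f (agree {1} (s≤s (s≤s z≤n)))) fv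
      light : ∀ {w i} → f (SearchOrder.at order i) ≡ 1 → pos w ≡ i → ¬ (2 ≤ f w)
      light {w} f≡1 refl 2≤f =
        ℕ.<-irrefl (sym (trans (sym (cong f (at-pos w))) f≡1)) 2≤f
      heavy : ∀ {w} → 2 ≤ f w → 2 ≤ pos w × 0 < f (SearchOrder.at order 1)
      heavy {w} 2≤f = ge (pos w) refl , ℕ.≤-reflexive (sym f₁)
        where
        ge : ∀ i → pos w ≡ i → 2 ≤ i
        ge zero          eq = contradiction 2≤f (light f₀ eq)
        ge (suc zero)    eq = contradiction 2≤f (light f₁ eq)
        ge (suc (suc i)) eq = s≤s (s≤s z≤n)

    -- Any vertex of positive weight may come first: its weight is then exactly 1.
    k≤1-light : ∀ {r} → 0 < f r → (∀ v → f v ≤ 1) →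
                IsCompetitionGraphWith (generalizedLineGraph H f) 1
    k≤1-light {r} 0<fr f≤1 with searchOrder connected (singletonPrefix r)
    ... | order , agree = Construction.isCompetitionGraphWith₁ f order
      (trans (cong f (agree {0} (s≤s z≤n))) (ℕ.≤-antisym (f≤1 r) 0<fr))
      (λ {w} 2≤f → contradiction (f≤1 w) (ℕ.<⇒≱ 2≤f))

theorem2p11 : (H : Graph) (f : Graph.Vertex H → ℕ) →
    Connected H → Edge H → ¬ (∀ v → f v ≡ 0) →
    (∃[ u ] ∃[ v ] (Graph.Adj H u v × f u ≡ 1 × f v ≡ 1)) ⊎ (∀ v → f v ≤ 1) →
    CompetitionNumber (generalizedLineGraph H f) 1
theorem2p11 H f connected e₀ f≢0 cases with finite-∃? (Graph.finite H) (λ v → 0 ℕ.<? f v)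
-- The finite search turns the negative hypothesis on `f` into a vertex of positive weight.
... | no none = contradiction (λ v → ℕ.n≤0⇒n≡0 (ℕ.≮⇒≥ λ 0<f → none (v , 0<f))) f≢0
... | yes (w , 0<fw) =
  [ (λ (_ , _ , a , fu , fv) → k≤1-edge H f connected a fu fv)
  , k≤1-light H f connected 0<fw ]′ cases ,
  noIsolated⇒k≥1 _ (inj₁ e₀) (GL-noIsolated H f connected e₀ 0<fw)
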